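{- Let $(G_m)_{m\in\mathbb{Z}}$ be a generalized Fibonacci sequence, let $a,b$ be integers, let $n\ge 0$ be an integer, and let $x$ be a complex number such that $\Delta := 1-L_b x+(-1)^b x^2\neq 0$. Then $$\begin{aligned} \sum_{k=0}^n x^k k^5 G_{a+bk} = {}& -\frac{1}{\Delta}(n+1)^5 x^{n+1} P(1,n+1) \\ & - \frac{1}{\Delta^2} \left[ (5n^4+30n^3+70n^2+75n+31) x^{n+2} P(2,n+2) - x P(2,1) \right] \\ & - \frac{10}{\Delta^3} \left[ (2n^3+12n^2+25n+18) x^{n+3} P(3,n+3) - 3 x^2 P(3,2) \right] \\ & - \frac{30}{\Delta^4} \left[ (2n^2+10n+13) x^{n+4} P(4,n+4) - 5 x^3 P(4,3) \right] \\ & - \frac{120}{\Delta^5} \left[ (n+3) x^{n+5} P(5,n+5) - 2 x^4 P(5,4) \right] \\ & - \frac{120}{\Delta^6} \left[ x^{n+6} P(6,n+6) - x^5 P(6,5) \right]. \end{aligned}$$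
   Context: A generalized Fibonacci sequence is a sequence $(G_m)_{m\in\mathbb{Z}}$ of complex numbers with $G_{m+2}=G_{m+1}+G_m$ for all integers $m$ (with arbitrary seed $G_0,G_1$). $L_m$ is the Lucas number: $L_0=2$, $L_1=1$, $L_{m+2}=L_{m+1}+L_m$ for all integers $m$ (including negative indices). For given $a,b,x$ and $G$, and for integers $v,w\ge 0$, $P(v,w) = \sum_{k=0}^v \binom{v}{k} (-1)^{(b+1)k} x^k G_{a+bw-bk}$. Convention: $x^0=1$, also for $x=0$. -}

module Defs where

open import Algebra.Apartness.Bundles using (HeytingCommutativeRing; HeytingField)
open import Algebra.Bundles using (CommutativeRing)
open import Data.Fin.Base using (toℕ)
open import Data.Integer.Base as ℤ using (ℤ; +_; -[1+_]; ∣_∣)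
open import Data.Integer.Tactic.RingSolver using (solve-∀)
open import Data.Nat.Base as ℕ using (ℕ; zero; suc)
open import Data.Nat.Combinatorics using (_C_)
open import Data.Product.Base using (proj₁; proj₂)
open import Relation.Binary.PropositionalEquality using (_≡_; refl; cong)
import Data.Integer.Properties as ℤₚ

-- Negative indices run the recurrence backwards, L m = L (m + 2) - L (m + 1);
-- the last two values are L (-1) and L (-2).
lucas : ℤ → ℤ
lucas (+ 0)               = + 2
lucas (+ 1)               = + 1
lucas (+ suc (suc n))     = lucas (+ suc n) ℤ.+ lucas (+ n)
lucas -[1+ 0 ]            = ℤ.- + 1
lucas -[1+ 1 ]            = + 3
lucas -[1+ suc (suc n) ]  = lucas -[1+ n ] ℤ.- lucas -[1+ suc n ]

lucas-recurrence : ∀ m → lucas (m ℤ.+ + 2) ≡ lucas (m ℤ.+ + 1) ℤ.+ lucas m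
lucas-recurrence (+ n) rewrite ℤₚ.+-comm (+ n) (+ 2) | ℤₚ.+-comm (+ n) (+ 1) = refl
lucas-recurrence -[1+ 0 ] = refl
lucas-recurrence -[1+ 1 ] = refl
lucas-recurrence -[1+ suc (suc n) ] = cancel (lucas -[1+ n ]) (lucas -[1+ suc n ])
  where
  cancel : ∀ i j → i ≡ j ℤ.+ (i ℤ.- j)
  cancel = solve-∀

-- The library has no complex numbers, so the scalars form an arbitrary Heyting
-- field (ℂ is one), whose apartness _#_ is the constructive form of ≠.
module OverField {c ℓ₁ ℓ₂} (F : HeytingField c ℓ₁ ℓ₂) where

  open HeytingField F public
  open CommutativeRing (HeytingCommutativeRing.commutativeRing heytingCommutativeRing)
    using (semiring)
  open import Algebra.Properties.Semiring.Exp semiring public using (_^_)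
  open import Algebra.Properties.Semiring.Mult semiring using (_×_)
  open import Algebra.Properties.Semiring.Sum semiring public using (sum⁺-syntax)
  open import Algebra.Apartness.Properties.HeytingCommutativeRing heytingCommutativeRing
    using (x-0≈x)

  fromℕ : ℕ → Carrier
  fromℕ n = n × 1#

  fromℤ : ℤ → Carrier
  fromℤ (+ n)    = fromℕ n
  fromℤ -[1+ n ] = - fromℕ (suc n)

  -- (-1)^e for an integer exponent e, using that -1 is its own inverse.
  sign : ℤ → Carrier
  sign e = (- 1#) ^ ∣ e ∣

  inv : ∀ x → x # 0# → Carrier
  inv x x#0 = proj₁ (#⇒invertible x#0)

  -- #⇒invertible speaks about x - 0#, hence this check.
  inv-inverseʳ : ∀ x (x#0 : x # 0#) → x * inv x x#0 ≈ 1#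
  inv-inverseʳ x x#0 =
    trans (*-congʳ (sym (x-0≈x x))) (proj₂ (proj₂ (#⇒invertible x#0)))

  IsGeneralizedFibonacci : (ℤ → Carrier) → Set ℓ₁
  IsGeneralizedFibonacci G = ∀ m → G (m ℤ.+ + 2) ≈ G (m ℤ.+ + 1) + G m

  Δ : ℤ → Carrier → Carrier
  Δ b x = 1# - fromℤ (lucas b) * x + sign b * x ^ 2

  P : (ℤ → Carrier) → ℤ → ℤ → Carrier → ℕ → ℕ → Carrier
  P G a b x v w = ∑[ k ≤ v ]
    (fromℕ (v C toℕ k) * sign ((b ℤ.+ + 1) ℤ.* + toℕ k) * x ^ toℕ k
      * G (a ℤ.+ b ℤ.* + w ℤ.- b ℤ.* + toℕ k))

{-# OPTIONS --safe #-}

-- Fix b, put s = (-1)ᵇ and let S be the shift of the sequence uₖ = xᵏ G(a + b k).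
-- The recurrence G(m + b) + s G(m - b) = L_b G(m) says L_b x = S + s x² S⁻¹,
-- whence Δ = (1 - S) T with T = 1 - s x² S⁻¹.  Since xʷ P(v,w) = (Tᵛ u)_w, the
-- quantities A(v,w) = Δ⁻ᵛ xʷ P(v,w) satisfy A(v,w) = A(v+1,w) - A(v+1,w+1), and
-- repeated summation by parts turns Σ k⁵ A(0,k) into the stated formula, whose
-- polynomials are the successive differences of (n+1)⁵.

module Submission where

open import Defs
open import Algebra.Apartness.Bundles using (HeytingCommutativeRing; HeytingField)
open import Algebra.Bundles using (CommutativeRing)
open import Algebra.Solver.Ring.AlmostCommutativeRing
  using (AlmostCommutativeRing; fromCommutativeRing; _-Raw-AlmostCommutative⟶_; Induced-equivalence)
open import Data.Fin.Base using (toℕ; inject₁) renaming (fromℕ to fromℕF)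
open import Data.Fin.Properties using (toℕ-inject₁; toℕ-fromℕ)
open import Data.Integer.Base as ℤ using (ℤ; +_; -[1+_]; ∣_∣)
open import Data.Integer.Tactic.RingSolver using (solve-∀)
open import Data.Nat.Base as ℕ using (ℕ; zero; suc)
open import Data.Nat.Combinatorics using (_C_; nCn≡1; nCk≡nC[n∸k]; nCk+nC[k+1]≡[n+1]C[k+1]; k>n⇒nCk≡0)
open import Data.Maybe.Base as Maybe using ()
open import Data.Sign.Base as Sign using ()
open import Function.Base using (_∘_)
open import Relation.Binary.Definitions using (WeaklyDecidable)
open import Relation.Binary.PropositionalEquality as ≡ using (_≡_; cong)
open import Relation.Nullary.Decidable using (dec⇒maybe)
import Algebra.Solver.Ring
import Data.Integer.Properties as ℤₚ
import Data.Nat.Properties as ℕₚ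
import Relation.Binary.Reasoning.Setoid

nC0≡1 : ∀ n → n C 0 ≡ 1
nC0≡1 n = ≡.trans (nCk≡nC[n∸k] {0} {n} ℕ.z≤n) (nCn≡1 n)

module Proof {c ℓ₁ ℓ₂} (F : HeytingField c ℓ₁ ℓ₂) where

  open OverField F

  commutativeRing : CommutativeRing c ℓ₁
  commutativeRing = HeytingCommutativeRing.commutativeRing heytingCommutativeRing

  open CommutativeRing commutativeRing using (semiring; commutativeSemiring; ring)
  open import Algebra.Properties.Semiring.Exp semiring using (^-assocʳ; ^-congˡ)
  open import Algebra.Properties.CommutativeSemiring.Exp commutativeSemiring using (^-distrib-*)
  open import Algebra.Properties.Semiring.Mult semiring using (×-homo-+; ×1-homo-*)
  open import Algebra.Properties.Semiring.Sum semiring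
    using (sum-syntax; sum-init-last; sum-cong-≋; sum-cong-≗; ∑-distrib-+; *-distribˡ-sum)
  open import Algebra.Properties.Ring ring
    using (-‿distribˡ-*; -‿distribʳ-*; -0#≈0#; -‿involutive; -‿+-comm)
  open Relation.Binary.Reasoning.Setoid setoid

  -- The canonical map from the integers as a ring homomorphism.

  fromℤ-neg : ∀ i → fromℤ (ℤ.- i) ≈ - fromℤ i
  fromℤ-neg (+ 0)      = sym -0#≈0#
  fromℤ-neg (+ suc n)  = refl
  fromℤ-neg -[1+ n ]   = sym (-‿involutive _)

  fromℤ-⊖ : ∀ m n → fromℤ (m ℤ.⊖ n) ≈ fromℕ m - fromℕ n
  fromℤ-⊖ m zero = begin
    fromℤ (m ℤ.⊖ 0)  ≡⟨⟩
    fromℕ m          ≈⟨ +-identityʳ _ ⟨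
    fromℕ m + 0#     ≈⟨ +-congˡ -0#≈0# ⟨
    fromℕ m - 0#     ∎
  fromℤ-⊖ zero (suc n) = sym (+-identityˡ _)
  fromℤ-⊖ (suc m) (suc n) = begin
    fromℤ (suc m ℤ.⊖ suc n)                  ≡⟨ cong fromℤ (ℤₚ.[1+m]⊖[1+n]≡m⊖n m n) ⟩
    fromℤ (m ℤ.⊖ n)                          ≈⟨ fromℤ-⊖ m n ⟩
    fromℕ m - fromℕ n                        ≈⟨ +-congʳ (+-identityʳ _) ⟨
    -- Inserting `1# - 1#` supplies the extra unit of both successors.
    fromℕ m + 0# - fromℕ n                   ≈⟨ +-congʳ (+-congˡ (-‿inverseʳ 1#)) ⟨
    fromℕ m + (1# - 1#) - fromℕ n            ≈⟨ +-congʳ (+-assoc _ _ _) ⟨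
    fromℕ m + 1# - 1# - fromℕ n              ≈⟨ +-assoc _ _ _ ⟩
    fromℕ m + 1# + (- 1# - fromℕ n)          ≈⟨ +-cong (+-comm _ _) (-‿+-comm _ _) ⟩
    fromℕ (suc m) - fromℕ (suc n)            ∎

  fromℤ-+ : ∀ i j → fromℤ (i ℤ.+ j) ≈ fromℤ i + fromℤ j
  fromℤ-+ (+ m) (+ n)        = ×-homo-+ 1# m n
  fromℤ-+ (+ m) -[1+ n ]     = fromℤ-⊖ m (suc n)
  fromℤ-+ -[1+ m ] (+ n)     = trans (fromℤ-⊖ n (suc m)) (+-comm _ _)
  fromℤ-+ -[1+ m ] -[1+ n ]  = begin
    - fromℕ (suc (suc (m ℕ.+ n)))      ≡⟨ cong (λ k → - fromℕ (suc k)) (ℕₚ.+-suc m n) ⟨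
    - fromℕ (suc m ℕ.+ suc n)          ≈⟨ -‿cong (×-homo-+ 1# (suc m) (suc n)) ⟩
    - (fromℕ (suc m) + fromℕ (suc n))  ≈⟨ -‿+-comm _ _ ⟨
    - fromℕ (suc m) - fromℕ (suc n)    ∎

  -- Integer multiplication of factors of opposite sign computes to this form, so both mixed cases
  -- of `fromℤ-*` reduce to it.
  fromℤ-◃⁻ : ∀ m n → fromℤ (Sign.- ℤ.◃ (m ℕ.* n)) ≈ - (fromℕ m * fromℕ n)
  fromℤ-◃⁻ m n = begin
    fromℤ (Sign.- ℤ.◃ (m ℕ.* n))  ≡⟨ cong fromℤ (ℤₚ.-◃n≡-n (m ℕ.* n)) ⟩
    fromℤ (ℤ.- (+ (m ℕ.* n)))     ≈⟨ fromℤ-neg (+ (m ℕ.* n)) ⟩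
    - fromℕ (m ℕ.* n)             ≈⟨ -‿cong (×1-homo-* m n) ⟩
    - (fromℕ m * fromℕ n)         ∎

  fromℤ-* : ∀ i j → fromℤ (i ℤ.* j) ≈ fromℤ i * fromℤ j
  fromℤ-* (+ m) (+ n) = trans (reflexive (cong fromℤ (ℤₚ.+◃n≡+n (m ℕ.* n)))) (×1-homo-* m n)
  fromℤ-* (+ m) -[1+ n ] = trans (fromℤ-◃⁻ m (suc n)) (-‿distribʳ-* _ _)
  fromℤ-* -[1+ m ] (+ n) = trans (fromℤ-◃⁻ (suc m) n) (-‿distribˡ-* _ _)
  fromℤ-* -[1+ m ] -[1+ n ] = begin
    fromℕ (suc m ℕ.* suc n)              ≈⟨ ×1-homo-* (suc m) (suc n) ⟩
    fromℕ (suc m) * fromℕ (suc n)        ≈⟨ -‿involutive _ ⟨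
    - - (fromℕ (suc m) * fromℕ (suc n))  ≈⟨ -‿cong (-‿distribˡ-* _ _) ⟩
    - (- fromℕ (suc m) * fromℕ (suc n))  ≈⟨ -‿distribʳ-* _ _ ⟩
    - fromℕ (suc m) * - fromℕ (suc n)    ∎

  -- A ring solver with integer coefficients.

  almostCommutativeRing : AlmostCommutativeRing c ℓ₁
  almostCommutativeRing = fromCommutativeRing commutativeRing

  -- With integers as coefficients the solver can do arithmetic on constants such as 70 and 120,
  -- which the final polynomial identities require.
  fromℤ-homo : ℤ.+-*-rawRing -Raw-AlmostCommutative⟶ almostCommutativeRing
  fromℤ-homo = record
    { ⟦_⟧    = fromℤ
    ; +-homo = fromℤ-+
    ; *-homo = fromℤ-*
    ; -‿homo = fromℤ-neg
    ; 0-homo = refl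
    ; 1-homo = +-identityʳ 1#
    }

  -- Coefficients are compared as integers, because equality in a Heyting field need not be
  -- decidable.
  fromℤ-≟ : WeaklyDecidable (Induced-equivalence fromℤ-homo)
  fromℤ-≟ i j = Maybe.map (reflexive ∘ cong fromℤ) (dec⇒maybe (i ℤₚ.≟ j))

  open Algebra.Solver.Ring ℤ.+-*-rawRing almostCommutativeRing fromℤ-homo fromℤ-≟
    using (Polynomial; con; _:+_; _:*_; _:-_; :-_; _:^_; _:=_; solve)

  -- Evaluates to 1# itself, whereas con (+ 1) evaluates to 1# + 0#.
  :1 : ∀ {m} → Polynomial m
  :1 = con (+ 1) :^ 0

  -- Generalized Fibonacci sequences are determined by their seeds.

  fibonacci-suc : ∀ {U} → IsGeneralizedFibonacci U →
                  ∀ n → U (+ suc (suc n)) ≈ U (+ suc n) + U (+ n)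
  fibonacci-suc {U} rec n = begin
    U (+ suc (suc n))          ≡⟨ cong (U ∘ +_) (ℕₚ.+-comm n 2) ⟨
    U (+ (n ℕ.+ 2))            ≈⟨ rec (+ n) ⟩
    U (+ (n ℕ.+ 1)) + U (+ n)  ≡⟨ cong (λ k → U (+ k) + U (+ n)) (ℕₚ.+-comm n 1) ⟩
    U (+ suc n) + U (+ n)      ∎

  fibonacci-pred : ∀ {U} → IsGeneralizedFibonacci U →
                   ∀ m → U m ≈ U (m ℤ.+ + 2) - U (m ℤ.+ + 1)
  fibonacci-pred {U} rec m = begin
    U m                                        ≈⟨ solve 2 (λ p q → q := p :+ q :- p) refl _ _ ⟩
    U (m ℤ.+ + 1) + U m - U (m ℤ.+ + 1)        ≈⟨ +-congʳ (rec m) ⟨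
    U (m ℤ.+ + 2) - U (m ℤ.+ + 1)              ∎

  -- Two-step induction from the seeds in both directions, with the recurrence run backwards on the
  -- negative half.
  fibonacci-unique : ∀ {U V} → IsGeneralizedFibonacci U → IsGeneralizedFibonacci V →
                     U (+ 0) ≈ V (+ 0) → U (+ 1) ≈ V (+ 1) → ∀ m → U m ≈ V m
  fibonacci-unique {U} {V} recU recV eq₀ eq₁ = go
    where
    forwards : ∀ n → U (+ suc n) ≈ V (+ suc n) → U (+ n) ≈ V (+ n) →
               U (+ suc (suc n)) ≈ V (+ suc (suc n))
    forwards n p q = trans (fibonacci-suc recU n)
                       (trans (+-cong p q) (sym (fibonacci-suc recV n)))

    backwards : ∀ m → U (m ℤ.+ + 2) ≈ V (m ℤ.+ + 2) →
                U (m ℤ.+ + 1) ≈ V (m ℤ.+ + 1) → U m ≈ V m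
    backwards m p q = trans (fibonacci-pred recU m)
                        (trans (+-cong p (-‿cong q)) (sym (fibonacci-pred recV m)))

    go : ∀ m → U m ≈ V m
    go (+ 0)               = eq₀
    go (+ 1)               = eq₁
    go (+ suc (suc n))     = forwards n (go (+ suc n)) (go (+ n))
    -- The sums with `+ 2` and `+ 1` compute: -1 steps down from the seeds at 1 and 0, and -2 from
    -- the values at 0 and -1.
    go -[1+ 0 ]            = backwards -[1+ 0 ] eq₁ eq₀
    go -[1+ 1 ]            = backwards -[1+ 1 ] eq₀ (go -[1+ 0 ])
    go -[1+ suc (suc n) ]  = backwards -[1+ suc (suc n) ] (go -[1+ n ]) (go -[1+ suc n ])

  -- Signs, and the Lucas shift identity.

  sign-suc : ∀ b → sign (b ℤ.+ + 1) ≈ - sign b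
  sign-suc (+ n) = begin
    (- 1#) ^ (n ℕ.+ 1)  ≡⟨ cong ((- 1#) ^_) (ℕₚ.+-comm n 1) ⟩
    - 1# * (- 1#) ^ n   ≈⟨ solve 1 (λ p → (:- :1) :* p := :- p) refl _ ⟩
    - (- 1#) ^ n        ∎
  -- For negative b, adding 1 lowers the absolute value, so the extra factor -1 now stands on the
  -- right-hand side.
  sign-suc -[1+ 0 ] = solve 0 (:1 := :- ((:- :1) :^ 1)) refl
  sign-suc -[1+ suc n ] = solve 1 (λ p → p := :- ((:- :1) :* p)) refl _

  sign-* : ∀ b k → sign (b ℤ.* + k) ≈ sign b ^ k
  sign-* b k = begin
    (- 1#) ^ ∣ b ℤ.* + k ∣    ≡⟨ cong ((- 1#) ^_) (ℤₚ.abs-* b (+ k)) ⟩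
    (- 1#) ^ (∣ b ∣ ℕ.* k)    ≈⟨ ^-assocʳ _ ∣ b ∣ k ⟨
    sign b ^ k                ∎

  lucas-fibonacci : ∀ g → IsGeneralizedFibonacci (λ b → fromℤ (lucas b) * g)
  lucas-fibonacci g b = begin
    fromℤ (lucas (b ℤ.+ + 2)) * g
      ≡⟨ cong (λ i → fromℤ i * g) (lucas-recurrence b) ⟩
    fromℤ (lucas (b ℤ.+ + 1) ℤ.+ lucas b) * g
      ≈⟨ *-congʳ (fromℤ-+ (lucas (b ℤ.+ + 1)) (lucas b)) ⟩
    (fromℤ (lucas (b ℤ.+ + 1)) + fromℤ (lucas b)) * g
      ≈⟨ distribʳ _ _ _ ⟩
    fromℤ (lucas (b ℤ.+ + 1)) * g + fromℤ (lucas b) * g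
      ∎

  module _ {G : ℤ → Carrier} (rec : IsGeneralizedFibonacci G) where

    G-cong : ∀ {i j} → i ≡ j → G i ≈ G j
    G-cong = reflexive ∘ cong G

    -- The second summand follows the recurrence backwards in b, which brings in a minus sign; the
    -- alternating factor `sign b` absorbs it.
    reflect-fibonacci : ∀ m → IsGeneralizedFibonacci (λ b → G (m ℤ.+ b) + sign b * G (m ℤ.- b))
    reflect-fibonacci m b = begin
      G (m ℤ.+ (b ℤ.+ + 2)) + sign (b ℤ.+ + 2) * G (m ℤ.- (b ℤ.+ + 2))
        ≈⟨ +-cong up (*-cong sign-suc-suc down) ⟩
      G (m ℤ.+ (b ℤ.+ + 1)) + G (m ℤ.+ b) + sign b * (G (m ℤ.- b) - G (m ℤ.- (b ℤ.+ + 1)))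
        ≈⟨ solve 5 (λ p q s y z → p :+ q :+ s :* (y :- z)
                               := p :+ (:- s) :* z :+ (q :+ s :* y)) refl _ _ _ _ _ ⟩
      G (m ℤ.+ (b ℤ.+ + 1)) + - sign b * G (m ℤ.- (b ℤ.+ + 1)) + (G (m ℤ.+ b) + sign b * G (m ℤ.- b))
        ≈⟨ +-congʳ (+-congˡ (*-congʳ (sign-suc b))) ⟨
      G (m ℤ.+ (b ℤ.+ + 1)) + sign (b ℤ.+ + 1) * G (m ℤ.- (b ℤ.+ + 1)) + (G (m ℤ.+ b) + sign b * G (m ℤ.- b))
        ∎
      where
      up : G (m ℤ.+ (b ℤ.+ + 2)) ≈ G (m ℤ.+ (b ℤ.+ + 1)) + G (m ℤ.+ b)
      up = begin
        G (m ℤ.+ (b ℤ.+ + 2))                ≈⟨ G-cong (ℤₚ.+-assoc m b (+ 2)) ⟨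
        G (m ℤ.+ b ℤ.+ + 2)                  ≈⟨ rec (m ℤ.+ b) ⟩
        G (m ℤ.+ b ℤ.+ + 1) + G (m ℤ.+ b)    ≈⟨ +-congʳ (G-cong (ℤₚ.+-assoc m b (+ 1))) ⟩
        G (m ℤ.+ (b ℤ.+ + 1)) + G (m ℤ.+ b)  ∎

      sign-suc-suc : sign (b ℤ.+ + 2) ≈ sign b
      sign-suc-suc = begin
        sign (b ℤ.+ + 2)          ≡⟨ cong sign (ℤₚ.+-assoc b (+ 1) (+ 1)) ⟨
        sign (b ℤ.+ + 1 ℤ.+ + 1)  ≈⟨ sign-suc (b ℤ.+ + 1) ⟩
        - sign (b ℤ.+ + 1)        ≈⟨ -‿cong (sign-suc b) ⟩
        - - sign b                ≈⟨ -‿involutive _ ⟩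
        sign b                    ∎

      cancel₂ : ∀ i j → i ℤ.- (j ℤ.+ + 2) ℤ.+ + 2 ≡ i ℤ.- j
      cancel₂ = solve-∀

      cancel₁ : ∀ i j → i ℤ.- (j ℤ.+ + 2) ℤ.+ + 1 ≡ i ℤ.- (j ℤ.+ + 1)
      cancel₁ = solve-∀

      down : G (m ℤ.- (b ℤ.+ + 2)) ≈ G (m ℤ.- b) - G (m ℤ.- (b ℤ.+ + 1))
      down = trans (fibonacci-pred rec _)
               (+-cong (G-cong (cancel₂ m b)) (-‿cong (G-cong (cancel₁ m b))))

    -- For fixed m both sides are generalized Fibonacci sequences in b, so comparing them at 0 and 1
    -- suffices. There they read G(m) + G(m) = 2 G(m) and G(m+1) - G(m-1) = G(m).
    lucas-shift : ∀ m b → G (m ℤ.+ b) + sign b * G (m ℤ.- b) ≈ fromℤ (lucas b) * G m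
    lucas-shift m = fibonacci-unique (reflect-fibonacci m) (lucas-fibonacci (G m)) eq₀ eq₁
      where
      eq₀ : G (m ℤ.+ + 0) + sign (+ 0) * G (m ℤ.- + 0) ≈ fromℤ (+ 2) * G m
      eq₀ = begin
        G (m ℤ.+ + 0) + 1# * G (m ℤ.- + 0)
          ≈⟨ +-cong (G-cong (ℤₚ.+-identityʳ m)) (*-congˡ (G-cong (ℤₚ.+-identityʳ m))) ⟩
        G m + 1# * G m
          ≈⟨ solve 1 (λ g → g :+ :1 :* g := con (+ 2) :* g) refl _ ⟩
        fromℤ (+ 2) * G m
          ∎

      cancel₂ : ∀ i → i ℤ.- + 1 ℤ.+ + 2 ≡ i ℤ.+ + 1
      cancel₂ = solve-∀

      cancel₁ : ∀ i → i ℤ.- + 1 ℤ.+ + 1 ≡ i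
      cancel₁ = solve-∀

      eq₁ : G (m ℤ.+ + 1) + sign (+ 1) * G (m ℤ.- + 1) ≈ fromℤ (+ 1) * G m
      eq₁ = begin
        G (m ℤ.+ + 1) + sign (+ 1) * G (m ℤ.- + 1)
          ≈⟨ +-congˡ (*-congˡ (trans (fibonacci-pred rec _)
               (+-cong (G-cong (cancel₂ m)) (-‿cong (G-cong (cancel₁ m)))))) ⟩
        G (m ℤ.+ + 1) + sign (+ 1) * (G (m ℤ.+ + 1) - G m)
          ≈⟨ solve 2 (λ p g → p :+ ((:- :1) :^ 1) :* (p :- g) := con (+ 1) :* g) refl _ _ ⟩
        fromℤ (+ 1) * G m
          ∎

  -- Binomial sums.

  sum-last : ∀ (f : ℕ → Carrier) n →
             ∑[ k ≤ n ] (f (toℕ k)) ≈ ∑[ k < n ] (f (toℕ k)) + f n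
  sum-last f n = begin
    ∑[ k ≤ n ] (f (toℕ k))
      ≈⟨ sum-init-last {n} (f ∘ toℕ) ⟩
    ∑[ k < n ] (f (toℕ (inject₁ k))) + f (toℕ (fromℕF n))
      ≡⟨ ≡.cong₂ _+_ (sum-cong-≗ {n} (cong f ∘ toℕ-inject₁)) (cong f (toℕ-fromℕ n)) ⟩
    ∑[ k < n ] (f (toℕ k)) + f n
      ∎

  binomialTerm : Carrier → ℕ → (ℕ → Carrier) → ℕ → Carrier
  binomialTerm t v h k = fromℕ (v C k) * t ^ k * h k

  -- This is the operator (1 + tE)ᵛ applied to `h` and evaluated at 0, where E sends `h` to
  -- `h ∘ suc`.
  binomialSum : Carrier → ℕ → (ℕ → Carrier) → Carrier
  binomialSum t v h = ∑[ k ≤ v ] (binomialTerm t v h (toℕ k))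

  binomialSum-cong : ∀ t v {g h} → (∀ k → g k ≈ h k) → binomialSum t v g ≈ binomialSum t v h
  binomialSum-cong t v {g} {h} g≈h = sum-cong-≋ {suc v} (term ∘ toℕ)
    where
    term : ∀ k → binomialTerm t v g k ≈ binomialTerm t v h k
    term k = *-congˡ (g≈h k)

  binomialSum-zero : ∀ t h → binomialSum t 0 h ≈ h 0
  binomialSum-zero t h = solve 1 (λ y → con (+ 1) :* :1 :* y :+ con (+ 0) := y) refl _

  -- One factor 1 + tE is split off. Termwise this is Pascal's rule for k ≥ 1, while at k = 0 both
  -- binomial coefficients are 1.
  binomialSum-suc : ∀ t v h →
    binomialSum t (suc v) h ≈ binomialSum t v h + t * binomialSum t v (h ∘ suc)
  binomialSum-suc t v h = begin
    binomialSum t (suc v) h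
      ≈⟨ +-cong (*-congʳ (*-congʳ (reflexive (cong fromℕ
           (≡.trans (nC0≡1 (suc v)) (≡.sym (nC0≡1 v)))))))
           (sum-cong-≋ {suc v} (pascal ∘ toℕ)) ⟩
    old 0 + ∑[ k ≤ v ] (old (suc (toℕ k)) + t * new (toℕ k))
      ≈⟨ +-congˡ (∑-distrib-+ {suc v} (old ∘ suc ∘ toℕ) (λ k → t * new (toℕ k))) ⟩
    old 0 + (∑[ k ≤ v ] (old (suc (toℕ k))) + ∑[ k ≤ v ] (t * new (toℕ k)))
      ≈⟨ +-assoc _ _ _ ⟨
    ∑[ k ≤ suc v ] (old (toℕ k)) + ∑[ k ≤ v ] (t * new (toℕ k))
      -- The sum of `old` runs one index too far; its last term contains `v C suc v`, which is zero.
      ≈⟨ +-cong (sum-last old (suc v)) (sym (*-distribˡ-sum {suc v} t (new ∘ toℕ))) ⟩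
    binomialSum t v h + old (suc v) + t * binomialSum t v (h ∘ suc)
      ≈⟨ +-congʳ (trans (+-congˡ vanish) (+-identityʳ _)) ⟩
    binomialSum t v h + t * binomialSum t v (h ∘ suc)
      ∎
    where
    old new : ℕ → Carrier
    old = binomialTerm t v h
    new = binomialTerm t v (h ∘ suc)

    pascal : ∀ k → binomialTerm t (suc v) h (suc k) ≈ old (suc k) + t * new k
    pascal k = begin
      fromℕ (suc v C suc k) * t ^ suc k * h (suc k)
        ≡⟨ cong (λ i → fromℕ i * t ^ suc k * h (suc k)) (nCk+nC[k+1]≡[n+1]C[k+1] v k) ⟨
      fromℕ (v C k ℕ.+ v C suc k) * t ^ suc k * h (suc k)
        ≈⟨ *-congʳ (*-congʳ (×-homo-+ 1# (v C k) (v C suc k))) ⟩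
      (fromℕ (v C k) + fromℕ (v C suc k)) * (t * t ^ k) * h (suc k)
        ≈⟨ solve 5 (λ p q t r y → (p :+ q) :* (t :* r) :* y
                               := q :* (t :* r) :* y :+ t :* (p :* r :* y)) refl _ _ _ _ _ ⟩
      old (suc k) + t * new k
        ∎

    vanish : old (suc v) ≈ 0#
    vanish = begin
      fromℕ (v C suc v) * t ^ suc v * h (suc v)
        ≡⟨ cong (λ i → fromℕ i * t ^ suc v * h (suc v)) (k>n⇒nCk≡0 (ℕₚ.n<1+n v)) ⟩
      0# * t ^ suc v * h (suc v)
        ≈⟨ trans (*-congʳ (zeroˡ _)) (zeroˡ _) ⟩
      0#
        ∎

  -- (1 + tE)ᵛ is linear and commutes with E, so it preserves a linear recurrence. The induction on
  -- v needs the hypothesis for both `h` and `h ∘ suc`.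
  binomialSum-recurrence : ∀ t v s l {h : ℕ → Carrier} →
    (∀ k → h k + s * h (suc (suc k)) ≈ l * h (suc k)) →
    binomialSum t v h + s * binomialSum t v (h ∘ suc ∘ suc) ≈ l * binomialSum t v (h ∘ suc)
  binomialSum-recurrence t zero s l {h} rec = begin
    binomialSum t 0 h + s * binomialSum t 0 (h ∘ suc ∘ suc)
      ≈⟨ +-cong (binomialSum-zero t h) (*-congˡ (binomialSum-zero t (h ∘ suc ∘ suc))) ⟩
    h 0 + s * h 2
      ≈⟨ rec 0 ⟩
    l * h 1
      ≈⟨ *-congˡ (binomialSum-zero t (h ∘ suc)) ⟨
    l * binomialSum t 0 (h ∘ suc)
      ∎
  binomialSum-recurrence t (suc v) s l {h} rec = begin
    binomialSum t (suc v) h + s * binomialSum t (suc v) (h ∘ suc ∘ suc)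
      ≈⟨ +-cong (binomialSum-suc t v h) (*-congˡ (binomialSum-suc t v (h ∘ suc ∘ suc))) ⟩
    B₀ + t * B₁ + s * (B₂ + t * B₃)
      ≈⟨ solve 6 (λ t s p q r u → p :+ t :* q :+ s :* (r :+ t :* u)
                               := (p :+ s :* r) :+ t :* (q :+ s :* u)) refl t s B₀ B₁ B₂ B₃ ⟩
    (B₀ + s * B₂) + t * (B₁ + s * B₃)
      ≈⟨ +-cong (binomialSum-recurrence t v s l rec)
                (*-congˡ (binomialSum-recurrence t v s l (rec ∘ suc))) ⟩
    l * B₁ + t * (l * B₂)
      ≈⟨ solve 4 (λ t l q r → l :* q :+ t :* (l :* r) := l :* (q :+ t :* r)) refl t l B₁ B₂ ⟩
    l * (B₁ + t * B₂)
      ≈⟨ *-congˡ (binomialSum-suc t v (h ∘ suc)) ⟨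
    l * binomialSum t (suc v) (h ∘ suc)
      ∎
    where
    B₀ B₁ B₂ B₃ : Carrier
    B₀ = binomialSum t v h
    B₁ = binomialSum t v (h ∘ suc)
    B₂ = binomialSum t v (h ∘ suc ∘ suc)
    B₃ = binomialSum t v (h ∘ suc ∘ suc ∘ suc)

  -- The sums P and their telescoping relation.

  module _ {G : ℤ → Carrier} (rec : IsGeneralizedFibonacci G) (a b : ℤ) (x : Carrier) where

    -- Since (-1)^(b+1) = -(-1)^b, the sign and the power of x merge into the k-th power of one
    -- scalar.
    binomialSum-P : ∀ v w →
      P G a b x v w ≈ binomialSum (- (sign b * x)) v (λ k → G (a ℤ.+ b ℤ.* + w ℤ.- b ℤ.* + k))
    binomialSum-P v w = sum-cong-≋ {suc v} (term ∘ toℕ)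
      where
      power : ∀ k → sign ((b ℤ.+ + 1) ℤ.* + k) * x ^ k ≈ (- (sign b * x)) ^ k
      power k = begin
        sign ((b ℤ.+ + 1) ℤ.* + k) * x ^ k  ≈⟨ *-congʳ (sign-* (b ℤ.+ + 1) k) ⟩
        sign (b ℤ.+ + 1) ^ k * x ^ k        ≈⟨ ^-distrib-* _ _ k ⟨
        (sign (b ℤ.+ + 1) * x) ^ k          ≈⟨ ^-congˡ k (*-congʳ (sign-suc b)) ⟩
        (- sign b * x) ^ k                  ≈⟨ ^-congˡ k (-‿distribˡ-* _ _) ⟨
        (- (sign b * x)) ^ k                ∎

      h : ℕ → Carrier
      h k = G (a ℤ.+ b ℤ.* + w ℤ.- b ℤ.* + k)

      term : ∀ k → fromℕ (v C k) * sign ((b ℤ.+ + 1) ℤ.* + k) * x ^ k * h k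
                 ≈ binomialTerm (- (sign b * x)) v h k
      term k = *-congʳ (trans (*-assoc _ _ _) (*-congˡ (power k)))

    P-zero : ∀ w → P G a b x 0 w ≈ G (a ℤ.+ b ℤ.* + w)
    P-zero w = begin
      P G a b x 0 w                          ≈⟨ binomialSum-P 0 w ⟩
      binomialSum (- (sign b * x)) 0 h       ≈⟨ binomialSum-zero (- (sign b * x)) h ⟩
      G (a ℤ.+ b ℤ.* + w ℤ.- b ℤ.* + 0)      ≈⟨ G-cong rec (drop a b (+ w)) ⟩
      G (a ℤ.+ b ℤ.* + w)                    ∎
      where
      drop : ∀ a b w → a ℤ.+ b ℤ.* w ℤ.- b ℤ.* + 0 ≡ a ℤ.+ b ℤ.* w
      drop = solve-∀

      h : ℕ → Carrier
      h k = G (a ℤ.+ b ℤ.* + w ℤ.- b ℤ.* + k)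

    -- This is Δ = (1 - S) T applied to Tᵛ u at index w, with the common factor xʷ left out, so that
    -- x = 0 is covered as well.
    P-telescope : ∀ v w →
      Δ b x * P G a b x v w ≈ P G a b x (suc v) w - x * P G a b x (suc v) (suc w)
    P-telescope v w = begin
      Δ b x * P G a b x v w
        ≈⟨ *-congˡ (P-shift v) ⟩
      (1# - l * x + s * x ^ 2) * B₁
        ≈⟨ solve 4 (λ x s l q → (:1 :- l :* x :+ s :* x :^ 2) :* q
                             := q :+ s :* x :^ 2 :* q :- x :* (l :* q)) refl x s l B₁ ⟩
      B₁ + s * x ^ 2 * B₁ - x * (l * B₁)
        ≈⟨ +-congˡ (-‿cong (*-congˡ (binomialSum-recurrence t v s l h-rec))) ⟨
      B₁ + s * x ^ 2 * B₁ - x * (B₀ + s * B₂)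
        -- Since x t = -(s x²), the terms regroup as `B₁ + t * B₂` and `B₀ + t * B₁`, the Pascal
        -- decompositions of the sums of order v + 1 at w and at w + 1.
        ≈⟨ solve 5 (λ x s p q r → q :+ s :* x :^ 2 :* q :- x :* (p :+ s :* r)
                    := q :+ (:- (s :* x)) :* r :- x :* (p :+ (:- (s :* x)) :* q)) refl x s B₀ B₁ B₂ ⟩
      B₁ + t * B₂ - x * (B₀ + t * B₁)
        ≈⟨ +-cong (binomialSum-suc t v (h ∘ suc)) (-‿cong (*-congˡ (binomialSum-suc t v h))) ⟨
      binomialSum t (suc v) (h ∘ suc) - x * binomialSum t (suc v) h
        ≈⟨ +-cong (P-shift (suc v)) (-‿cong (*-congˡ (binomialSum-P (suc v) (suc w)))) ⟨
      P G a b x (suc v) w - x * P G a b x (suc v) (suc w)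
        ∎
      where
      s l t : Carrier
      s = sign b
      l = fromℤ (lucas b)
      t = - (s * x)

      -- Starting at w + 1 makes the sums at w + 1, w and w - 1 successive shifts of one sequence;
      -- the last cannot always be written with `P`, whose index is a natural number.
      h : ℕ → Carrier
      h k = G (a ℤ.+ b ℤ.* + suc w ℤ.- b ℤ.* + k)

      B₀ B₁ B₂ : Carrier
      B₀ = binomialSum t v h
      B₁ = binomialSum t v (h ∘ suc)
      B₂ = binomialSum t v (h ∘ suc ∘ suc)

      -- `+ 1 ℤ.+ + k` computes to `+ suc k`, so these identities in a free integer k apply to
      -- successors directly.
      forwards : ∀ c b k → c ℤ.- b ℤ.* k ≡ c ℤ.- b ℤ.* (+ 1 ℤ.+ k) ℤ.+ b
      forwards = solve-∀

      backwards : ∀ c b k → c ℤ.- b ℤ.* (+ 2 ℤ.+ k) ≡ c ℤ.- b ℤ.* (+ 1 ℤ.+ k) ℤ.- b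
      backwards = solve-∀

      -- Raising k lowers the index by b, so `h k` and `h (suc (suc k))` lie at distance b on either
      -- side of `h (suc k)`, as `lucas-shift` requires.
      h-rec : ∀ k → h k + s * h (suc (suc k)) ≈ l * h (suc k)
      h-rec k = begin
        h k + s * h (suc (suc k))
          ≈⟨ +-cong (G-cong rec (forwards (a ℤ.+ b ℤ.* + suc w) b (+ k)))
                    (*-congˡ (G-cong rec (backwards (a ℤ.+ b ℤ.* + suc w) b (+ k)))) ⟩
        G (m ℤ.+ b) + s * G (m ℤ.- b)
          ≈⟨ lucas-shift rec m b ⟩
        l * h (suc k)
          ∎
        where
        m : ℤ
        m = a ℤ.+ b ℤ.* + suc w ℤ.- b ℤ.* + suc k

      shift : ∀ a b w k → a ℤ.+ b ℤ.* w ℤ.- b ℤ.* k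
                        ≡ a ℤ.+ b ℤ.* (+ 1 ℤ.+ w) ℤ.- b ℤ.* (+ 1 ℤ.+ k)
      shift = solve-∀

      P-shift : ∀ u → P G a b x u w ≈ binomialSum t u (h ∘ suc)
      P-shift u = trans (binomialSum-P u w)
        (binomialSum-cong t u (λ k → G-cong rec (shift a b (+ w) (+ k))))

  -- Summation by parts against fifth powers.

  -- Here aᵢ stands for A i (i + n) and cᵢ for A i (i - 1).
  closedForm : (ν a₁ a₂ a₃ a₄ a₅ a₆ c₂ c₃ c₄ c₅ c₆ : Carrier) → Carrier
  closedForm ν a₁ a₂ a₃ a₄ a₅ a₆ c₂ c₃ c₄ c₅ c₆ =
    - ((ν + 1#) ^ 5 * a₁)
      - ((fromℕ 5 * ν ^ 4 + fromℕ 30 * ν ^ 3 + fromℕ 70 * ν ^ 2 + fromℕ 75 * ν + fromℕ 31) * a₂ - c₂)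
      - fromℕ 10 * ((fromℕ 2 * ν ^ 3 + fromℕ 12 * ν ^ 2 + fromℕ 25 * ν + fromℕ 18) * a₃ - fromℕ 3 * c₃)
      - fromℕ 30 * ((fromℕ 2 * ν ^ 2 + fromℕ 10 * ν + fromℕ 13) * a₄ - fromℕ 5 * c₄)
      - fromℕ 120 * ((ν + fromℕ 3) * a₅ - fromℕ 2 * c₅)
      - fromℕ 120 * (a₆ - c₆)

  module _ {m : ℕ} where

    :fromℕ : ℕ → Polynomial m
    :fromℕ n = con (+ n)

    -- The solver's copy of `closedForm`, which evaluates to it by computation.
    :closedForm : (ν a₁ a₂ a₃ a₄ a₅ a₆ c₂ c₃ c₄ c₅ c₆ : Polynomial m) → Polynomial m
    :closedForm ν a₁ a₂ a₃ a₄ a₅ a₆ c₂ c₃ c₄ c₅ c₆ =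
      :- ((ν :+ :1) :^ 5 :* a₁)
        :- ((:fromℕ 5 :* ν :^ 4 :+ :fromℕ 30 :* ν :^ 3 :+ :fromℕ 70 :* ν :^ 2 :+ :fromℕ 75 :* ν
               :+ :fromℕ 31) :* a₂ :- c₂)
        :- :fromℕ 10 :* ((:fromℕ 2 :* ν :^ 3 :+ :fromℕ 12 :* ν :^ 2 :+ :fromℕ 25 :* ν :+ :fromℕ 18) :* a₃
               :- :fromℕ 3 :* c₃)
        :- :fromℕ 30 :* ((:fromℕ 2 :* ν :^ 2 :+ :fromℕ 10 :* ν :+ :fromℕ 13) :* a₄ :- :fromℕ 5 :* c₄)
        :- :fromℕ 120 :* ((ν :+ :fromℕ 3) :* a₅ :- :fromℕ 2 :* c₅)
        :- :fromℕ 120 :* (a₆ :- c₆)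

  closedForm-cong : ∀ {ν a₁ a₂ a₃ a₄ a₅ a₆ c₂ c₃ c₄ c₅ c₆ a₁′ a₂′ a₃′ a₄′ a₅′ a₆′ c₂′ c₃′ c₄′ c₅′ c₆′} →
    a₁ ≈ a₁′ → a₂ ≈ a₂′ → a₃ ≈ a₃′ → a₄ ≈ a₄′ → a₅ ≈ a₅′ → a₆ ≈ a₆′ →
    c₂ ≈ c₂′ → c₃ ≈ c₃′ → c₄ ≈ c₄′ → c₅ ≈ c₅′ → c₆ ≈ c₆′ →
    closedForm ν a₁ a₂ a₃ a₄ a₅ a₆ c₂ c₃ c₄ c₅ c₆ ≈
    closedForm ν a₁′ a₂′ a₃′ a₄′ a₅′ a₆′ c₂′ c₃′ c₄′ c₅′ c₆′
  closedForm-cong p₁ p₂ p₃ p₄ p₅ p₆ q₂ q₃ q₄ q₅ q₆ =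
    +-cong (+-cong (+-cong (+-cong (+-cong (-‿cong (*-congˡ p₁))
      (-‿cong (+-cong (*-congˡ p₂) (-‿cong q₂))))
      (-‿cong (*-congˡ (+-cong (*-congˡ p₃) (-‿cong (*-congˡ q₃))))))
      (-‿cong (*-congˡ (+-cong (*-congˡ p₄) (-‿cong (*-congˡ q₄))))))
      (-‿cong (*-congˡ (+-cong (*-congˡ p₅) (-‿cong (*-congˡ q₅))))))
      (-‿cong (*-congˡ (+-cong p₆ (-‿cong q₆))))

  -- The entries cᵢ are the aᵢ at n = -1, and their coefficients are the values of the polynomials
  -- there: 0, 1, 3, 5, 2, 1. Hence the expression formally vanishes at n = -1, in agreement with
  -- the empty sum.
  closedFormAt : (ℕ → ℕ → Carrier) → ℕ → Carrier
  closedFormAt A n = closedForm (fromℕ n) (A 1 (1 ℕ.+ n)) (A 2 (2 ℕ.+ n)) (A 3 (3 ℕ.+ n))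
    (A 4 (4 ℕ.+ n)) (A 5 (5 ℕ.+ n)) (A 6 (6 ℕ.+ n)) (A 2 1) (A 3 2) (A 4 3) (A 5 4) (A 6 5)

  module _ (A : ℕ → ℕ → Carrier)
           (telescope : ∀ v w → A (suc v) w ≈ A v w + A (suc v) (suc w)) where

    -- Iterated summation by parts, verified by induction on n: once `telescope` has made the
    -- entries match, each case is a polynomial identity in free variables.
    sum-k⁵A₀ : ∀ n → ∑[ k ≤ n ] (fromℕ (toℕ k) ^ 5 * A 0 (toℕ k)) ≈ closedFormAt A n
    sum-k⁵A₀ zero = begin
      0# ^ 5 * A 0 0 + 0#
        -- At n = 0 each cᵢ equals aᵢ₋₁ + aᵢ by `telescope`, and all aᵢ then cancel; a₀ drops out
        -- because of the factor 0⁵.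
        ≈⟨ solve 7 (λ a₀ a₁ a₂ a₃ a₄ a₅ a₆ →
             con (+ 0) :^ 5 :* a₀ :+ con (+ 0) :=
             :closedForm (con (+ 0)) a₁ a₂ a₃ a₄ a₅ a₆
               (a₁ :+ a₂) (a₂ :+ a₃) (a₃ :+ a₄) (a₄ :+ a₅) (a₅ :+ a₆))
             refl (A 0 0) (A 1 1) (A 2 2) (A 3 3) (A 4 4) (A 5 5) (A 6 6) ⟩
      closedForm 0# (A 1 1) (A 2 2) (A 3 3) (A 4 4) (A 5 5) (A 6 6)
        (A 1 1 + A 2 2) (A 2 2 + A 3 3) (A 3 3 + A 4 4) (A 4 4 + A 5 5) (A 5 5 + A 6 6)
        ≈⟨ closedForm-cong refl refl refl refl refl refl
             (telescope 1 1) (telescope 2 2) (telescope 3 3) (telescope 4 4) (telescope 5 5) ⟨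
      closedFormAt A 0
        ∎
    sum-k⁵A₀ (suc n) = begin
      ∑[ k ≤ suc n ] (fromℕ (toℕ k) ^ 5 * A 0 (toℕ k))
        ≈⟨ sum-last (λ k → fromℕ k ^ 5 * A 0 k) (suc n) ⟩
      ∑[ k ≤ n ] (fromℕ (toℕ k) ^ 5 * A 0 (toℕ k)) + fromℕ (suc n) ^ 5 * a 0
        ≈⟨ +-congʳ (sum-k⁵A₀ n) ⟩
      closedFormAt A n + fromℕ (suc n) ^ 5 * a 0
        ≈⟨ +-congʳ (closedForm-cong (telescope 0 _) (telescope 1 _) (telescope 2 _)
             (telescope 3 _) (telescope 4 _) (telescope 5 _) refl refl refl refl refl) ⟩
      closedForm (fromℕ n) (a 0 + a 1) (a 1 + a 2) (a 2 + a 3) (a 3 + a 4) (a 4 + a 5) (a 5 + a 6)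
        (A 2 1) (A 3 2) (A 4 3) (A 5 4) (A 6 5) + fromℕ (suc n) ^ 5 * a 0
        -- If pᵢ(ν) is the full coefficient of -aᵢ, comparing coefficients asks for pᵢ₊₁(ν) =
        -- pᵢ(ν+1) - pᵢ(ν), with p₁ = (ν+1)⁵ and p₆ = 120. The new summand cancels a₀.
        ≈⟨ solve 13 (λ ν a₀ a₁ a₂ a₃ a₄ a₅ a₆ c₂ c₃ c₄ c₅ c₆ →
             :closedForm ν (a₀ :+ a₁) (a₁ :+ a₂) (a₂ :+ a₃) (a₃ :+ a₄) (a₄ :+ a₅) (a₅ :+ a₆)
               c₂ c₃ c₄ c₅ c₆ :+ (:1 :+ ν) :^ 5 :* a₀ :=
             :closedForm (:1 :+ ν) a₁ a₂ a₃ a₄ a₅ a₆ c₂ c₃ c₄ c₅ c₆)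
             refl (fromℕ n) (a 0) (a 1) (a 2) (a 3) (a 4) (a 5) (a 6)
             (A 2 1) (A 3 2) (A 4 3) (A 5 4) (A 6 5) ⟩
      closedFormAt A (suc n)
        ∎
      where
      a : ℕ → Carrier
      a i = A i (i ℕ.+ suc n)

  -- Application to the scaled sums.

  module _ {G : ℤ → Carrier} (rec : IsGeneralizedFibonacci G)
           (a b : ℤ) (x : Carrier) (Δ#0 : Δ b x # 0#) where

    private
      δ : Carrier
      δ = inv (Δ b x) Δ#0

      Q : ℕ → ℕ → Carrier
      Q = P G a b x

    scaledP : ℕ → ℕ → Carrier
    scaledP v w = δ ^ v * (x ^ w * Q v w)

    -- This is `P-telescope` multiplied by δᵛ⁺¹ xʷ; one factor δ cancels Δ.
    scaledP-telescope : ∀ v w → scaledP (suc v) w ≈ scaledP v w + scaledP (suc v) (suc w)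
    scaledP-telescope v w = begin
      δ * δ ^ v * (x ^ w * Q (suc v) w)
        ≈⟨ solve 6 (λ δ dv x xw p q → δ :* dv :* (xw :* p)
             := δ :* dv :* (xw :* (p :- x :* q)) :+ δ :* dv :* (x :* xw :* q))
             refl δ (δ ^ v) x (x ^ w) (Q (suc v) w) (Q (suc v) (suc w)) ⟩
      δ * δ ^ v * (x ^ w * (Q (suc v) w - x * Q (suc v) (suc w))) + scaledP (suc v) (suc w)
        ≈⟨ +-congʳ (*-congˡ (*-congˡ (P-telescope rec a b x v w))) ⟨
      δ * δ ^ v * (x ^ w * (Δ b x * Q v w)) + scaledP (suc v) (suc w)
        ≈⟨ +-congʳ (solve 5 (λ δ dv xw d p → δ :* dv :* (xw :* (d :* p)) := d :* δ :* (dv :* (xw :* p)))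
             refl δ (δ ^ v) (x ^ w) (Δ b x) (Q v w)) ⟩
      Δ b x * δ * scaledP v w + scaledP (suc v) (suc w)
        ≈⟨ +-congʳ (trans (*-congʳ (inv-inverseʳ (Δ b x) Δ#0)) (*-identityˡ _)) ⟩
      scaledP v w + scaledP (suc v) (suc w)
        ∎

    scaledP-zero : ∀ k →
      x ^ k * fromℕ k ^ 5 * G (a ℤ.+ b ℤ.* + k) ≈ fromℕ k ^ 5 * scaledP 0 k
    scaledP-zero k = begin
      x ^ k * fromℕ k ^ 5 * G (a ℤ.+ b ℤ.* + k)
        ≈⟨ *-congˡ (P-zero rec a b x k) ⟨
      x ^ k * fromℕ k ^ 5 * Q 0 k
        ≈⟨ solve 3 (λ y κ q → y :* κ :* q := κ :* (:1 :* (y :* q))) refl _ _ _ ⟩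
      fromℕ k ^ 5 * scaledP 0 k
        ∎

    -- Brings a bracket of `closedForm` into the shape of the theorem: κ is the numerical factor, t
    -- the power of δ, q and d the coefficients, y and z the powers of x, p and r the values of `P`.
    gather : ∀ κ t q y p d z r → κ * (q * (t * (y * p)) - d * (t * (z * r)))
                               ≈ κ * t * (q * y * p - d * z * r)
    gather = solve 8 (λ κ t q y p d z r →
      κ :* (q :* (t :* (y :* p)) :- d :* (t :* (z :* r)))
        := κ :* t :* (q :* y :* p :- d :* z :* r)) refl

    sum-k⁵xᵏG : ∀ n → let ν = fromℕ n in
      ∑[ k ≤ n ] (x ^ toℕ k * fromℕ (toℕ k) ^ 5 * G (a ℤ.+ b ℤ.* + toℕ k))
      ≈ - (δ * (ν + 1#) ^ 5 * x ^ (1 ℕ.+ n) * Q 1 (1 ℕ.+ n))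
        - δ ^ 2 * ((fromℕ 5 * ν ^ 4 + fromℕ 30 * ν ^ 3 + fromℕ 70 * ν ^ 2 + fromℕ 75 * ν + fromℕ 31)
                       * x ^ (2 ℕ.+ n) * Q 2 (2 ℕ.+ n)
                     - x * Q 2 1)
        - fromℕ 10 * δ ^ 3 * ((fromℕ 2 * ν ^ 3 + fromℕ 12 * ν ^ 2 + fromℕ 25 * ν + fromℕ 18)
                                  * x ^ (3 ℕ.+ n) * Q 3 (3 ℕ.+ n)
                                - fromℕ 3 * x ^ 2 * Q 3 2)
        - fromℕ 30 * δ ^ 4 * ((fromℕ 2 * ν ^ 2 + fromℕ 10 * ν + fromℕ 13)
                                  * x ^ (4 ℕ.+ n) * Q 4 (4 ℕ.+ n)
                                - fromℕ 5 * x ^ 3 * Q 4 3)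
        - fromℕ 120 * δ ^ 5 * ((ν + fromℕ 3) * x ^ (5 ℕ.+ n) * Q 5 (5 ℕ.+ n)
                                 - fromℕ 2 * x ^ 4 * Q 5 4)
        - fromℕ 120 * δ ^ 6 * (x ^ (6 ℕ.+ n) * Q 6 (6 ℕ.+ n) - x ^ 5 * Q 6 5)
    sum-k⁵xᵏG n = begin
      ∑[ k ≤ n ] (x ^ toℕ k * fromℕ (toℕ k) ^ 5 * G (a ℤ.+ b ℤ.* + toℕ k))
        ≈⟨ sum-cong-≋ {suc n} (scaledP-zero ∘ toℕ) ⟩
      ∑[ k ≤ n ] (fromℕ (toℕ k) ^ 5 * scaledP 0 (toℕ k))
        ≈⟨ sum-k⁵A₀ scaledP scaledP-telescope n ⟩
      closedFormAt scaledP n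
        -- Only the brackets of orders 3, 4 and 5 have the shape of `gather`. The others omit
        -- trivial factors or hide the exponent 1, and are solved separately.
        ≈⟨ +-cong (+-cong (+-cong (+-cong (+-cong
             (-‿cong (solve 4 (λ δ q y p → q :* (δ :^ 1 :* (y :* p)) := δ :* q :* y :* p)
               refl _ _ _ _))
             (-‿cong (solve 6 (λ t q y p x r → q :* (t :* (y :* p)) :- t :* (x :^ 1 :* r)
                                            := t :* (q :* y :* p :- x :* r))
               refl _ _ _ _ _ _)))
             (-‿cong (gather _ _ _ _ _ _ _ _)))
             (-‿cong (gather _ _ _ _ _ _ _ _)))
             (-‿cong (gather _ _ _ _ _ _ _ _)))
             (-‿cong (solve 6 (λ κ t y p z r → κ :* (t :* (y :* p) :- t :* (z :* r))
                                            := κ :* t :* (y :* p :- z :* r))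
               refl _ _ _ _ _ _)) ⟩
      _ ∎

mainTheorem6 :
  ∀ {c ℓ₁ ℓ₂} (F : HeytingField c ℓ₁ ℓ₂) → let open OverField F in
  (G : ℤ → Carrier) → IsGeneralizedFibonacci G →
  (a b : ℤ) (n : ℕ) (x : Carrier) (Δ#0 : Δ b x # 0#) →
  let Δ⁻¹ = inv (Δ b x) Δ#0
      Q = P G a b x
      ν = fromℕ n
  in
  ∑[ k ≤ n ] (x ^ toℕ k * fromℕ (toℕ k) ^ 5 * G (a ℤ.+ b ℤ.* + toℕ k))
  ≈ - (Δ⁻¹ * (ν + 1#) ^ 5 * x ^ (n ℕ.+ 1) * Q 1 (n ℕ.+ 1))
    - Δ⁻¹ ^ 2 * ((fromℕ 5 * ν ^ 4 + fromℕ 30 * ν ^ 3 + fromℕ 70 * ν ^ 2 + fromℕ 75 * ν + fromℕ 31)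
                   * x ^ (n ℕ.+ 2) * Q 2 (n ℕ.+ 2)
                 - x * Q 2 1)
    - fromℕ 10 * Δ⁻¹ ^ 3 * ((fromℕ 2 * ν ^ 3 + fromℕ 12 * ν ^ 2 + fromℕ 25 * ν + fromℕ 18)
                              * x ^ (n ℕ.+ 3) * Q 3 (n ℕ.+ 3)
                            - fromℕ 3 * x ^ 2 * Q 3 2)
    - fromℕ 30 * Δ⁻¹ ^ 4 * ((fromℕ 2 * ν ^ 2 + fromℕ 10 * ν + fromℕ 13)
                              * x ^ (n ℕ.+ 4) * Q 4 (n ℕ.+ 4)
                            - fromℕ 5 * x ^ 3 * Q 4 3)
    - fromℕ 120 * Δ⁻¹ ^ 5 * ((ν + fromℕ 3) * x ^ (n ℕ.+ 5) * Q 5 (n ℕ.+ 5)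
                             - fromℕ 2 * x ^ 4 * Q 5 4)
    - fromℕ 120 * Δ⁻¹ ^ 6 * (x ^ (n ℕ.+ 6) * Q 6 (n ℕ.+ 6)
                             - x ^ 5 * Q 6 5)
mainTheorem6 F G rec a b n x Δ#0
  -- With the numeral in front, the sums compute to successors of n, the form used in the induction.
  rewrite ℕₚ.+-comm n 1 | ℕₚ.+-comm n 2 | ℕₚ.+-comm n 3
        | ℕₚ.+-comm n 4 | ℕₚ.+-comm n 5 | ℕₚ.+-comm n 6
  = Proof.sum-k⁵xᵏG F rec a b x Δ#0 n
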